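{- Let $n$ be a positive integer. The Labelle merging algorithm $$(P,Q)\longmapsto U\,p_1\,q_1'\,p_2\,q_2'\cdots p_{2n}\,q_{2n}'\,D,$$ where $P=p_1p_2\cdots p_{2n}$, $Q=q_1q_2\cdots q_{2n}$, and $U'=D$, $D'=U$, is a bijection between the set of pairs $(P,Q)$ of noncrossing free Dyck paths of length $2n$ and the set of Dyck paths of length $4n+2$ with exactly $n+1$ up steps at odd positions.
   Context: A free Dyck path of length $2n$ is a lattice path from $(0,0)$ to $(2n,0)$ with up steps $U=(1,1)$ and down steps $D=(1,-1)$, represented as a sequence of $n$ letters $U$ and $n$ letters $D$; it is allowed to go below the $x$-axis. A Dyck path is a free Dyck path that never goes below the $x$-axis. A pair of noncrossing free Dyck paths of length $2n$ is an ordered pair $(P,Q)$ of free Dyck paths of length $2n$ such that $P$ never goes below $Q$ (they may touch or share steps). The steps of a path are numbered by positions $1,2,3,\ldots$ from left to right; an up step at an odd position is a letter $U$ occurring as the $i$-th step with $i$ odd. -}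

module Defs where

open import Data.Integer using (ℤ; 0ℤ; 1ℤ; -1ℤ; _+_; _≤_)
open import Data.List using (List; []; _∷_; _∷ʳ_; concat; foldr; length; take; zipWith)
open import Data.Nat using (ℕ; suc)
open import Data.Product using (Σ; _×_; _,_; proj₁)
open import Function using (_on_)
open import Level using (0ℓ)
open import Relation.Binary using (Rel)
open import Relation.Binary.PropositionalEquality using (_≡_)
open import Relation.Unary using (Pred)

data Step : Set where
  U D : Step

infix 9 _′

_′ : Step → Step
U ′ = D
D ′ = U

-- All paths start at (0,0), so a path is determined by its steps.
Path : Set
Path = List Step

rise : Step → ℤ
rise U = 1ℤ
rise D = -1ℤ

-- Ordinate of the endpoint; the abscissa of the endpoint is the length.
height : Path → ℤ
height = foldr (λ s h → rise s + h) 0ℤ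

-- `heightAt k w` is the ordinate of w at abscissa k, for k ≤ length w; for
-- larger k it is constantly the final ordinate, so quantifying over all k
-- below imposes no additional condition.
heightAt : ℕ → Path → ℤ
heightAt k w = height (take k w)

-- The first argument ℓ is the length of the path, which ends at (ℓ,0).
IsFreeDyckPath : ℕ → Pred Path 0ℓ
IsFreeDyckPath ℓ w = length w ≡ ℓ × height w ≡ 0ℤ

IsDyckPath : ℕ → Pred Path 0ℓ
IsDyckPath ℓ w = IsFreeDyckPath ℓ w × (∀ k → 0ℤ ≤ heightAt k w)

_NeverBelow_ : Rel Path 0ℓ
P NeverBelow Q = ∀ k → heightAt k Q ≤ heightAt k P

IsNoncrossingPair : ℕ → Pred (Path × Path) 0ℓ
IsNoncrossingPair ℓ (P , Q) =
  IsFreeDyckPath ℓ P × IsFreeDyckPath ℓ Q × P NeverBelow Q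

-- Positions are numbered from 1: the head of the list is at an odd position.
atOddPositions : ∀ {A : Set} → List A → List A
atOddPositions []           = []
atOddPositions (x ∷ [])     = x ∷ []
atOddPositions (x ∷ _ ∷ xs) = x ∷ atOddPositions xs

#U : Path → ℕ
#U []      = 0
#U (U ∷ w) = suc (#U w)
#U (D ∷ w) = #U w

IsDyckPathWithOddUps : ℕ → ℕ → Pred Path 0ℓ
IsDyckPathWithOddUps ℓ m w = IsDyckPath ℓ w × #U (atOddPositions w) ≡ m

-- `zipWith` truncates to the shorter list; this never happens for paths of
-- equal length.
labelleMerge : Path × Path → Path
labelleMerge (P , Q) =
  U ∷ concat (zipWith (λ p q → p ∷ q ′ ∷ []) P Q) ∷ʳ D

-- Equality of elements of the subset { x | S x }, disregarding the membership
-- proofs.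
EqualIn : ∀ {A : Set} (S : Pred A 0ℓ) → Rel (Σ A S) 0ℓ
EqualIn S = _≡_ on proj₁

{-# OPTIONS --safe #-}

-- After 2k + 1 steps the merged path has ordinate 1 + (P_k − Q_k), where P_k
-- and Q_k are the ordinates of P and Q at abscissa k.  Since P_k − Q_k is even,
-- the merged path is nonnegative at odd abscissae exactly when P_k ≥ Q_k for all
-- k, and then it is ≥ 1 there, so the even abscissae are automatic.  The odd
-- positions carry U q₁′ q₂′ …, so having n + 1 up steps there says that Q has n
-- down steps; P then returns to the axis because the merged path does.
-- Conversely a Dyck path starts with U and ends with D, and the steps in between
-- can be split into pairs p q′ in exactly one way.

module Submission where

open import Defs
open import Data.Nat using (ℕ; NonZero; _+_; _*_)
open import Data.Product using (Σ-syntax; _,_)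
open import Function.Definitions using (Bijective)

open import Data.Fin using (zero; suc)
open import Data.Integer
  using (+_; -[1+_]; 0ℤ; 1ℤ; -1ℤ; -_; +≤+; -≤+)
  renaming (_+_ to _+ℤ_; _-_ to _-ℤ_; _≤_ to _≤ℤ_)
import Data.Integer.Properties as ℤ
open import Algebra.Properties.AbelianGroup ℤ.+-0-abelianGroup using (∙-cancelʳ)
open import Data.Integer.Tactic.RingSolver using (solve-∀)
open import Data.List using ([]; _∷_; _∷ʳ_; _++_; concat; length; map; take; zipWith; initLast; _∷ʳ′_)
open import Data.List.Properties
  using (∷-injectiveˡ; ∷-injectiveʳ; ∷ʳ-injectiveˡ; length-++; length-take; take-[])
open import Data.Nat using (zero; suc; _⊓_; z≤n)
open import Data.Nat.DivMod using (DivMod; _divMod_; result)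
import Data.Nat.Properties as ℕ
import Data.Nat.Tactic.RingSolver as ℕ-Solver
open import Data.Product using (_×_; proj₁; proj₂; ∃; ∃₂)
open import Data.Sum using (_⊎_; inj₁; inj₂)
open import Relation.Binary.PropositionalEquality
  using (_≡_; refl; sym; trans; cong; cong₂; subst; module ≡-Reasoning)
open import Relation.Nullary using (contradiction)

private variable
  P Q w : Path

-- The merge without its outer steps: `labelleMerge (P , Q)` is definitionally
-- `U ∷ interleave P Q ∷ʳ D`, so facts about `interleave` transfer without rewriting.
interleave : Path → Path → Path
interleave P Q = concat (zipWith (λ p q → p ∷ q ′ ∷ []) P Q)

′-involutive : ∀ s → (s ′) ′ ≡ s
′-involutive U = refl
′-involutive D = refl

′-injective : ∀ {s t} → s ′ ≡ t ′ → s ≡ t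
′-injective {s} {t} eq =
  trans (sym (′-involutive s)) (trans (cong _′ eq) (′-involutive t))

rise-′ : ∀ s → rise (s ′) ≡ - rise s
rise-′ U = refl
rise-′ D = refl

-- Heights of paths and of their prefixes

height-++ : ∀ v w → height (v ++ w) ≡ height v +ℤ height w
height-++ []      w = sym (ℤ.+-identityˡ _)
height-++ (s ∷ v) w =
  trans (cong (rise s +ℤ_) (height-++ v w)) (sym (ℤ.+-assoc (rise s) _ _))

height-∷ʳ : ∀ v s → height (v ∷ʳ s) ≡ height v +ℤ rise s
height-∷ʳ v s =
  trans (height-++ v (s ∷ [])) (cong (height v +ℤ_) (ℤ.+-identityʳ (rise s)))

height-U∷ʳD : ∀ v → height (U ∷ v ∷ʳ D) ≡ height v
height-U∷ʳD v = trans (cong (1ℤ +ℤ_) (height-∷ʳ v D)) (cancel (height v))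
  where
  cancel : ∀ h → 1ℤ +ℤ (h +ℤ -1ℤ) ≡ h
  cancel = solve-∀

heightAt-length-++ : ∀ v w → heightAt (length v) (v ++ w) ≡ height v
heightAt-length-++ []      w = refl
heightAt-length-++ (s ∷ v) w = cong (rise s +ℤ_) (heightAt-length-++ v w)

-- The first case is `k ≤ length v`; for larger `k` the prefix is already the whole path.
heightAt-∷ʳ : ∀ k v s → heightAt k (v ∷ʳ s) ≡ heightAt k v ⊎ heightAt k (v ∷ʳ s) ≡ height (v ∷ʳ s)
heightAt-∷ʳ zero    v       s = inj₁ refl
heightAt-∷ʳ (suc k) []      s = inj₂ (cong (λ u → height (s ∷ u)) (take-[] k))
heightAt-∷ʳ (suc k) (t ∷ v) s with heightAt-∷ʳ k v s
... | inj₁ eq = inj₁ (cong (rise t +ℤ_) eq)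
... | inj₂ eq = inj₂ (cong (rise t +ℤ_) eq)

-- The sides agree up to the end of `v`; past it the left one has descended once more. An inequality
-- serves every `k`, so no bound on `k` has to be carried along.
heightAt-∷ʳD-≤ : ∀ k v → heightAt k (v ∷ʳ D) ≤ℤ heightAt k v
heightAt-∷ʳD-≤ zero          v       = ℤ.≤-refl
heightAt-∷ʳD-≤ (suc zero)    []      = -≤+
heightAt-∷ʳD-≤ (suc (suc k)) []      = -≤+
heightAt-∷ʳD-≤ (suc k)       (s ∷ v) = ℤ.+-monoʳ-≤ (rise s) (heightAt-∷ʳD-≤ k v)

0≤1+rise : ∀ s → 0ℤ ≤ℤ 1ℤ +ℤ rise s
0≤1+rise U = +≤+ z≤n
0≤1+rise D = +≤+ z≤n

-- A single step descends by at most 1, and past the end the ordinate stays constant.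
heightAt-≤-1+heightAt-suc : ∀ k w → heightAt k w ≤ℤ 1ℤ +ℤ heightAt (suc k) w
heightAt-≤-1+heightAt-suc zero    []      = +≤+ z≤n
heightAt-≤-1+heightAt-suc (suc k) []      = +≤+ z≤n
heightAt-≤-1+heightAt-suc zero    (s ∷ w) =
  subst (λ h → 0ℤ ≤ℤ 1ℤ +ℤ h) (sym (ℤ.+-identityʳ (rise s))) (0≤1+rise s)
heightAt-≤-1+heightAt-suc (suc k) (s ∷ w) =
  subst (heightAt (suc k) (s ∷ w) ≤ℤ_) (swap (rise s) (heightAt (suc k) w))
    (ℤ.+-monoʳ-≤ (rise s) (heightAt-≤-1+heightAt-suc k w))
  where
  swap : ∀ r h → r +ℤ (1ℤ +ℤ h) ≡ 1ℤ +ℤ (r +ℤ h)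
  swap = solve-∀

-- `#U (map _′ w)` counts the down steps. Length is ups plus downs and height is ups minus downs, so
-- they differ by twice the downs.
length-height : ∀ w → + length w ≡ height w +ℤ (+ #U (map _′ w) +ℤ + #U (map _′ w))
length-height []      = refl
length-height (U ∷ w) =
  trans (cong (1ℤ +ℤ_) (length-height w)) (sym (ℤ.+-assoc 1ℤ (height w) _))
length-height (D ∷ w) =
  trans (cong (1ℤ +ℤ_) (length-height w)) (shift (height w) (+ #U (map _′ w)))
  where
  shift : ∀ h d → 1ℤ +ℤ (h +ℤ (d +ℤ d)) ≡ (-1ℤ +ℤ h) +ℤ ((1ℤ +ℤ d) +ℤ (1ℤ +ℤ d))
  shift = solve-∀

-- Length, height and odd positions of the interleaving

length-interleave : ∀ P Q → length P ≡ length Q → length (interleave P Q) ≡ length P * 2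
length-interleave []      []      _  = refl
length-interleave (p ∷ P) (q ∷ Q) eq =
  cong (λ l → suc (suc l)) (length-interleave P Q (ℕ.suc-injective eq))

height-interleave : ∀ P Q → length P ≡ length Q →
                    height (interleave P Q) ≡ height P -ℤ height Q
height-interleave []      []      _  = refl
height-interleave (p ∷ P) (q ∷ Q) eq = begin
  rise p +ℤ (rise (q ′) +ℤ height (interleave P Q))
    ≡⟨ cong₂ (λ r h → rise p +ℤ (r +ℤ h)) (rise-′ q)
             (height-interleave P Q (ℕ.suc-injective eq)) ⟩
  rise p +ℤ (- rise q +ℤ (height P -ℤ height Q))
    ≡⟨ regroup (rise p) (rise q) (height P) (height Q) ⟩
  (rise p +ℤ height P) -ℤ (rise q +ℤ height Q) ∎
  where
  open ≡-Reasoning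
  regroup : ∀ a b h k → a +ℤ (- b +ℤ (h -ℤ k)) ≡ (a +ℤ h) -ℤ (b +ℤ k)
  regroup = solve-∀

take-interleave : ∀ k P Q → take (k * 2) (interleave P Q) ≡ interleave (take k P) (take k Q)
take-interleave zero    P       Q       = refl
take-interleave (suc k) []      Q       = refl
take-interleave (suc k) (p ∷ P) []      = refl
take-interleave (suc k) (p ∷ P) (q ∷ Q) = cong (λ u → p ∷ q ′ ∷ u) (take-interleave k P Q)

length-take-≡ : ∀ k → length P ≡ length Q → length (take k P) ≡ length (take k Q)
length-take-≡ {P} {Q} k eq =
  trans (length-take k P) (trans (cong (k ⊓_) eq) (sym (length-take k Q)))

heightAt-interleave : ∀ k → length P ≡ length Q →
  heightAt (k * 2) (interleave P Q) ≡ heightAt k P -ℤ heightAt k Q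
heightAt-interleave {P} {Q} k eq =
  trans (cong height (take-interleave k P Q))
        (height-interleave (take k P) (take k Q) (length-take-≡ {P} {Q} k eq))

-- The head `s` is arbitrary so that the induction closes: once `s` and `p` are consumed, `q ′` is
-- the next step at an odd position.
atOddPositions-interleave : ∀ s P Q → length P ≡ length Q →
  atOddPositions (s ∷ interleave P Q ∷ʳ D) ≡ s ∷ map _′ Q
atOddPositions-interleave s []      []      _  = refl
atOddPositions-interleave s (p ∷ P) (q ∷ Q) eq =
  cong (s ∷_) (atOddPositions-interleave (q ′) P Q (ℕ.suc-injective eq))

-- Equal lengths matter here: otherwise `zipWith` would discard the surplus steps of the longer
-- path, which could not be recovered.
interleave-injective : ∀ P₁ Q₁ P₂ Q₂ → length P₁ ≡ length Q₁ → length P₂ ≡ length Q₂ →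
  interleave P₁ Q₁ ≡ interleave P₂ Q₂ → (P₁ , Q₁) ≡ (P₂ , Q₂)
interleave-injective []        []        []        []        _  _  _  = refl
interleave-injective []        []        (_ ∷ _)   (_ ∷ _)   _  _  ()
interleave-injective (_ ∷ _)   (_ ∷ _)   []        []        _  _  ()
interleave-injective (p₁ ∷ P₁) (q₁ ∷ Q₁) (p₂ ∷ P₂) (q₂ ∷ Q₂) l₁ l₂ eq =
  cong₂ (λ (p , q) (P , Q) → (p ∷ P , q ∷ Q))
    (cong₂ _,_ (∷-injectiveˡ eq) (′-injective (∷-injectiveˡ (∷-injectiveʳ eq))))
    (interleave-injective P₁ Q₁ P₂ Q₂ (ℕ.suc-injective l₁) (ℕ.suc-injective l₂)
      (∷-injectiveʳ (∷-injectiveʳ eq)))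

interleave-surjective : ∀ l v → length v ≡ l * 2 →
  ∃₂ λ P Q → length P ≡ l × length Q ≡ l × v ≡ interleave P Q
interleave-surjective zero    []          _  = [] , [] , refl , refl , refl
interleave-surjective (suc l) (s ∷ t ∷ v) eq =
  let P , Q , lP , lQ , v≡ = interleave-surjective l v (ℕ.suc-injective (ℕ.suc-injective eq))
  in s ∷ P , t ′ ∷ Q , cong suc lP , cong suc lQ ,
     cong₂ (λ r u → s ∷ r ∷ u) (sym (′-involutive t)) v≡

-- Parity and nonnegativity

height-diff-even : length P ≡ length Q → ∃ λ z → height P -ℤ height Q ≡ z +ℤ z
-- By `length-height` each height is the length minus twice the number of down steps. The equal
-- lengths cancel, leaving twice the difference of the down-step counts.
height-diff-even {P} {Q} eq = dQ -ℤ dP ,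
  (begin
    height P -ℤ height Q
      ≡⟨ expand (height P) (height Q) dP dQ ⟩
    ((height P +ℤ (dP +ℤ dP)) -ℤ (height Q +ℤ (dQ +ℤ dQ))) +ℤ rest
      ≡⟨ cong₂ (λ a b → (a -ℤ b) +ℤ rest) (sym (length-height P)) (sym (length-height Q)) ⟩
    (+ length P -ℤ + length Q) +ℤ rest
      ≡⟨ cong (λ l → (+ l -ℤ + length Q) +ℤ rest) eq ⟩
    (+ length Q -ℤ + length Q) +ℤ rest
      ≡⟨ cong (_+ℤ rest) (ℤ.+-inverseʳ (+ length Q)) ⟩
    0ℤ +ℤ rest
      ≡⟨ ℤ.+-identityˡ rest ⟩
    rest ∎)
  where
  open ≡-Reasoning
  dP = + #U (map _′ P)
  dQ = + #U (map _′ Q)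
  rest = (dQ -ℤ dP) +ℤ (dQ -ℤ dP)
  expand : ∀ h k a b → h -ℤ k ≡
    ((h +ℤ (a +ℤ a)) -ℤ (k +ℤ (b +ℤ b))) +ℤ ((b -ℤ a) +ℤ (b -ℤ a))
  expand = solve-∀

-- A negative `z` would make `1 + 2z` at most -1.
0≤1+2z⇒0≤2z : ∀ z → 0ℤ ≤ℤ 1ℤ +ℤ (z +ℤ z) → 0ℤ ≤ℤ z +ℤ z
0≤1+2z⇒0≤2z (+ _)     _  = +≤+ z≤n
0≤1+2z⇒0≤2z -[1+ _ ] ()

-- The bound is -1 because the leading `U` of the merged path lifts everything by 1. At even
-- abscissae the height is an ordinate of `P` minus one of `Q`, hence nonnegative; an odd abscissa
-- lies one step further.
neverBelow⇒interleave-≥-1 : length P ≡ length Q → P NeverBelow Q →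
  ∀ k → 0ℤ ≤ℤ 1ℤ +ℤ heightAt k (interleave P Q)
neverBelow⇒interleave-≥-1 {P} {Q} eq P≥Q k = go (k divMod 2)
  where
  even≥0 : ∀ j → 0ℤ ≤ℤ heightAt (j * 2) (interleave P Q)
  even≥0 j = subst (0ℤ ≤ℤ_) (sym (heightAt-interleave {P} {Q} j eq)) (ℤ.i≤j⇒0≤j-i (P≥Q j))
  go : ∀ {k} → DivMod k 2 → 0ℤ ≤ℤ 1ℤ +ℤ heightAt k (interleave P Q)
  go (result j zero       refl) = ℤ.i≤j⇒i≤k+j 1ℤ (even≥0 j)
  go (result j (suc zero) refl) =
    ℤ.≤-trans (even≥0 j) (heightAt-≤-1+heightAt-suc (j * 2) (interleave P Q))

nonneg-U∷ʳD : ∀ v → height v ≡ 0ℤ → (∀ k → 0ℤ ≤ℤ 1ℤ +ℤ heightAt k v) →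
              ∀ k → 0ℤ ≤ℤ heightAt k (U ∷ v ∷ʳ D)
nonneg-U∷ʳD v hv v≥-1 zero    = ℤ.≤-refl
nonneg-U∷ʳD v hv v≥-1 (suc k) with heightAt-∷ʳ k v D
-- Within `v` the leading `U` compensates for the bound -1; beyond `v` the path has returned to the
-- axis.
... | inj₁ eq = subst (λ h → 0ℤ ≤ℤ 1ℤ +ℤ h) (sym eq) (v≥-1 k)
... | inj₂ eq = ℤ.≤-reflexive (sym (trans (cong (1ℤ +ℤ_) eq) (trans (height-U∷ʳD v) hv)))

-- P − Q is even at every abscissa, so a lower bound -1 is already a lower bound 0.
nonneg⇒neverBelow : length P ≡ length Q →
  (∀ k → 0ℤ ≤ℤ heightAt k (U ∷ interleave P Q ∷ʳ D)) → P NeverBelow Q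
nonneg⇒neverBelow {P} {Q} eq w≥0 k = ℤ.0≤i-j⇒j≤i
  (let z , even = height-diff-even {take k P} {take k Q} (length-take-≡ {P} {Q} k eq)
       ≥-1 = ℤ.≤-trans (w≥0 (suc (k * 2)))
               (ℤ.+-monoʳ-≤ 1ℤ (heightAt-∷ʳD-≤ (k * 2) (interleave P Q)))
       ≡2z = trans (heightAt-interleave {P} {Q} k eq) even
   in subst (0ℤ ≤ℤ_) (sym even)
        (0≤1+2z⇒0≤2z z (subst (λ h → 0ℤ ≤ℤ 1ℤ +ℤ h) ≡2z ≥-1)))

-- A first step `D` would reach -1 at abscissa 1, and a last step `U` ending on the axis would have
-- to start at -1. The length `2 + l` makes the first and last steps distinct.
dyck-U∷ʳD : ∀ {l} → IsDyckPath (2 + l) w → ∃ λ v → w ≡ U ∷ v ∷ʳ D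
dyck-U∷ʳD {D ∷ _} (_ , w≥0) with () ← w≥0 1
dyck-U∷ʳD {U ∷ w} ((len , end) , w≥0) with initLast w
... | v ∷ʳ′ D = v , refl
... | v ∷ʳ′ U = contradiction (subst (0ℤ ≤ℤ_) 1+hv≡-1 1+hv≥0) λ ()
  where
  1+hv≥0 : 0ℤ ≤ℤ 1ℤ +ℤ height v
  1+hv≥0 = subst (λ h → 0ℤ ≤ℤ 1ℤ +ℤ h) (heightAt-length-++ v (U ∷ [])) (w≥0 (suc (length v)))
  regroup : ∀ h → 1ℤ +ℤ h ≡ (1ℤ +ℤ (h +ℤ 1ℤ)) +ℤ -1ℤ
  regroup = solve-∀
  1+hv≡-1 : 1ℤ +ℤ height v ≡ -1ℤ
  1+hv≡-1 = trans (regroup (height v))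
    (cong (_+ℤ -1ℤ) (trans (cong (1ℤ +ℤ_) (sym (height-∷ʳ v U))) end))

-- Ending on the axis as a count of down steps

freeDyck⇒#D : ∀ n → IsFreeDyckPath (2 * n) w → #U (map _′ w) ≡ n
freeDyck⇒#D {w} n (len , end) = ℕ.*-cancelˡ-≡ d n 2 (ℤ.+-injective (begin
  + (2 * d)                    ≡⟨ cong (λ m → + (d + m)) (ℕ.+-identityʳ d) ⟩
  + (d + d)                    ≡⟨ ℤ.+-identityˡ _ ⟨
  0ℤ +ℤ (+ d +ℤ + d)         ≡⟨ cong (_+ℤ (+ d +ℤ + d)) end ⟨
  height w +ℤ (+ d +ℤ + d)   ≡⟨ length-height w ⟨
  + length w                   ≡⟨ cong +_ len ⟩
  + (2 * n)                    ∎))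
  where
  open ≡-Reasoning
  d = #U (map _′ w)

-- This turns the condition on odd positions back into the return of `Q` to the axis: by
-- `length-height`, the height is `2 * n` minus twice the `n` down steps.
#D⇒freeDyck : ∀ n → length w ≡ 2 * n → #U (map _′ w) ≡ n → IsFreeDyckPath (2 * n) w
#D⇒freeDyck {w} n len refl = len , ∙-cancelʳ (+ n +ℤ + n) (height w) 0ℤ (begin
  height w +ℤ (+ n +ℤ + n)   ≡⟨ length-height w ⟨
  + length w                   ≡⟨ cong +_ len ⟩
  + (2 * n)                    ≡⟨ cong (λ m → + (n + m)) (ℕ.+-identityʳ n) ⟩
  + (n + n)                    ≡⟨ ℤ.+-identityˡ _ ⟨
  0ℤ +ℤ (+ n +ℤ + n)         ∎)
  where open ≡-Reasoning

length-U∷ʳD : ∀ v → length (U ∷ v ∷ʳ D) ≡ length v + 2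
length-U∷ʳD v = trans (cong suc (length-++ v)) (sym (ℕ.+-suc (length v) 1))

2*n*2≡4*n : ∀ n → 2 * n * 2 ≡ 4 * n
2*n*2≡4*n = ℕ-Solver.solve-∀

-- The merge as a bijection

labelleMerge-wellDefined : ∀ n PQ → IsNoncrossingPair (2 * n) PQ →
  IsDyckPathWithOddUps (4 * n + 2) (n + 1) (labelleMerge PQ)
labelleMerge-wellDefined n (P , Q) ((lP , hP) , freeQ@(lQ , hQ) , P≥Q) =
  ((len , trans (height-U∷ʳD v) hv) ,
   nonneg-U∷ʳD v hv (neverBelow⇒interleave-≥-1 {P} {Q} lPQ P≥Q)) ,
  oddUps
  where
  v = interleave P Q
  lPQ : length P ≡ length Q
  lPQ = trans lP (sym lQ)
  hv : height v ≡ 0ℤ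
  hv = trans (height-interleave P Q lPQ) (cong₂ _-ℤ_ hP hQ)
  len : length (U ∷ v ∷ʳ D) ≡ 4 * n + 2
  len = trans (length-U∷ʳD v) (cong (_+ 2)
    (trans (length-interleave P Q lPQ) (trans (cong (_* 2) lP) (2*n*2≡4*n n))))
  oddUps : #U (atOddPositions (U ∷ v ∷ʳ D)) ≡ n + 1
  oddUps = trans (cong #U (atOddPositions-interleave U P Q lPQ))
    (trans (cong suc (freeDyck⇒#D {Q} n freeQ)) (ℕ.+-comm 1 n))

labelleMerge-injective : ∀ n {PQ₁ PQ₂} →
  IsNoncrossingPair (2 * n) PQ₁ → IsNoncrossingPair (2 * n) PQ₂ →
  labelleMerge PQ₁ ≡ labelleMerge PQ₂ → PQ₁ ≡ PQ₂
labelleMerge-injective n {P₁ , Q₁} {P₂ , Q₂}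
  ((lP₁ , _) , (lQ₁ , _) , _) ((lP₂ , _) , (lQ₂ , _) , _) eq =
  interleave-injective P₁ Q₁ P₂ Q₂ (trans lP₁ (sym lQ₁)) (trans lP₂ (sym lQ₂))
    (∷ʳ-injectiveˡ _ _ (∷-injectiveʳ eq))

labelleMerge-surjective : ∀ n w → IsDyckPathWithOddUps (4 * n + 2) (n + 1) w →
  ∃ λ PQ → IsNoncrossingPair (2 * n) PQ × labelleMerge PQ ≡ w
labelleMerge-surjective n w (dyck , oddUps)
  with v , refl ← dyck-U∷ʳD (subst (λ l → IsDyckPath l w) (ℕ.+-comm (4 * n) 2) dyck)
  with P , Q , lP , lQ , refl ← interleave-surjective (2 * n) v
         (trans (ℕ.+-cancelʳ-≡ 2 _ _ (trans (sym (length-U∷ʳD v)) (proj₁ (proj₁ dyck))))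
                (sym (2*n*2≡4*n n)))
  = (P , Q) , ((lP , hP) , freeQ , nonneg⇒neverBelow {P} {Q} lPQ (proj₂ dyck)) , refl
  where
  lPQ : length P ≡ length Q
  lPQ = trans lP (sym lQ)
  freeQ : IsFreeDyckPath (2 * n) Q
  freeQ = #D⇒freeDyck {Q} n lQ (ℕ.suc-injective
    (trans (sym (cong #U (atOddPositions-interleave U P Q lPQ))) (trans oddUps (ℕ.+-comm n 1))))
  hP : height P ≡ 0ℤ
  hP = ℤ.i-j≡0⇒i≡j (height P) 0ℤ (begin
    height P -ℤ 0ℤ        ≡⟨ cong (height P -ℤ_) (proj₂ freeQ) ⟨
    height P -ℤ height Q  ≡⟨ height-interleave P Q lPQ ⟨
    height v               ≡⟨ height-U∷ʳD v ⟨
    height (U ∷ v ∷ʳ D)    ≡⟨ proj₂ (proj₁ dyck) ⟩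
    0ℤ                     ∎)
    where open ≡-Reasoning

theorem3p1 : (n : ℕ) → .{{_ : NonZero n}} →
    Σ[ wellDefined ∈ (∀ PQ → IsNoncrossingPair (2 * n) PQ →
    IsDyckPathWithOddUps (4 * n + 2) (n + 1) (labelleMerge PQ)) ]
    Bijective (EqualIn (IsNoncrossingPair (2 * n)))
    (EqualIn (IsDyckPathWithOddUps (4 * n + 2) (n + 1)))
    (λ (PQ , nc) → labelleMerge PQ , wellDefined PQ nc)
theorem3p1 n =
  labelleMerge-wellDefined n ,
  (λ {(_ , nc₁)} {(_ , nc₂)} eq → labelleMerge-injective n nc₁ nc₂ eq) ,
  λ (w , isW) → let PQ , nc , eq = labelleMerge-surjective n w isW in
    -- Surjectivity asks about every `z` equal to the chosen preimage under `EqualIn`. Such a `z`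
    -- has the same pair of paths, so it has the same merge, whatever its membership proof.
    (PQ , nc) , λ z≡ → trans (cong labelleMerge z≡) eq
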